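{- $$\sum_{\pi\in\mathcal{G}_N^{O}}q^{|\pi|}=(-q;q)_\infty^2 .$$
   Context: An overpartition is a finite non-increasing sequence of positive integers (its parts) in which the first occurrence of each number may be overlined (so for each size $t$ at most one part of size $t$ is overlined); the size of a part $t$ or $\overline{t}$ is $t$, and the weight $|\pi|$ is the sum of the sizes of the parts. The empty overpartition has weight $0$. $\mathcal{G}_N^{O}$ is the set of overpartitions (including the empty one) such that the sizes of overlined parts (if any exist) are greater than the sizes of all non-overlined parts. Here $|q|<1$ (or $q$ is a formal variable), $(a;q)_\infty=\prod_{i=0}^{\infty}(1-aq^i)$. -}

module Defs where

open import Level using (0ℓ)
open import Algebra.Bundles using (RawRing)
import Algebra.Definitions.RawSemiring as RawSemiringDefinitions
open import Data.Bool.Base using (Bool; T)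
open import Data.Fin.Base using (toℕ)
open import Data.Fin.Properties using (toℕ<n)
open import Data.Integer.Base as ℤ using (ℤ; 0ℤ; 1ℤ)
import Data.Integer.Properties as ℤ
open import Algebra.Properties.CommutativeMonoid.Sum ℤ.+-0-commutativeMonoid
  using (sum⁺-syntax; sum-cong-≗; sum-replicate-zero)
open import Data.List.Base using (List; foldr; map)
open import Data.List.Membership.Propositional using (_∈_)
open import Data.List.Relation.Unary.All using (All)
open import Data.List.Relation.Unary.AllPairs using (AllPairs)
open import Data.List.Relation.Unary.Unique.Propositional using (Unique)
open import Data.Nat.Base as ℕ using (ℕ; zero; suc; _∸_; _≤_; _<_; _≥_; NonZero)
open import Data.Nat.ListAction using (sum)
import Data.Nat.Properties as ℕ
open import Data.Product.Base using (Σ; _×_)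
open import Relation.Binary.PropositionalEquality
  using (_≡_; _≢_; _≗_; refl; sym; trans; cong; cong₂; subst)
open import Relation.Nullary using (¬_; yes; no)
open import Relation.Unary using (Pred)

record Part : Set where
  constructor part
  field
    size      : ℕ
    overlined : Bool

open Part public

Overlined : Part → Set
Overlined p = T (overlined p)

weight : List Part → ℕ
weight π = sum (map size π)

record IsOverpartition (π : List Part) : Set where
  field
    positive        : All (λ p → NonZero (size p)) π
    nonIncreasing   : AllPairs (λ p r → size p ≥ size r) π
    -- An overlined part has no part of the same size before it.
    overlinedFirst  : AllPairs (λ p r → Overlined r → size p ≢ size r) π

record G-N-O (π : List Part) : Set where
  field
    isOverpartition : IsOverpartition π
    separated       : ∀ {p r} → p ∈ π → r ∈ π → Overlined p → ¬ Overlined r →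
                      size r < size p

-- Formal power series in q with integer coefficients;
-- f n is the coefficient of q^n in f.

PowerSeries : Set
PowerSeries = ℕ → ℤ

0ₛ 1ₛ q : PowerSeries

0ₛ _ = 0ℤ

1ₛ zero    = 1ℤ
1ₛ (suc _) = 0ℤ

q zero    = 0ℤ
q (suc n) = 1ₛ n

infix  8 -_
infixl 7 _*_
infixl 6 _+_ _-_

_+_ _*_ : PowerSeries → PowerSeries → PowerSeries
-_ : PowerSeries → PowerSeries

(f + g) n = f n ℤ.+ g n
(- f) n   = ℤ.- f n
(f * g) n = ∑[ i ≤ n ] (f (toℕ i) ℤ.* g (n ∸ toℕ i))

_-_ : PowerSeries → PowerSeries → PowerSeries
f - g = f + (- g)

powerSeriesRawRing : RawRing 0ℓ 0ℓ
powerSeriesRawRing = record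
  { Carrier = PowerSeries
  ; _≈_     = _≗_
  ; _+_     = _+_
  ; _*_     = _*_
  ; -_      = -_
  ; 0#      = 0ₛ
  ; 1#      = 1ₛ
  }

open RawSemiringDefinitions (RawRing.rawSemiring powerSeriesRawRing) public
  using (_^_)

-- F is the sum of the (possibly infinite) family f over the subset S of I:
-- for every n, all but finitely many i in S contribute nothing to the
-- coefficient of q^n, and the remaining contributions add up to F n.
IsSumOver : {I : Set} → Pred I 0ℓ → (I → PowerSeries) → PowerSeries → Set
IsSumOver {I} S f F = ∀ n → Σ (List I) λ is →
    Unique is
  × (∀ {i} → i ∈ is → S i)
  × (∀ {i} → S i → f i n ≢ 0ℤ → i ∈ is)
  × foldr ℤ._+_ 0ℤ (map (λ i → f i n) is) ≡ F n

-- (a;q)_n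
pochhammer : PowerSeries → ℕ → PowerSeries
pochhammer a zero    = 1ₛ
pochhammer a (suc n) = pochhammer a n * (1ₛ - a * q ^ n)

-- (a;q)_∞, the coefficientwise limit of (a;q)_m as m → ∞: the coefficient of
-- q^n no longer changes once m > n, see pochhammer-stable.
pochhammer∞ : PowerSeries → PowerSeries
pochhammer∞ a n = pochhammer a (suc n) n

private
  VanishesBelow : ℕ → PowerSeries → Set
  VanishesBelow k f = ∀ {n} → n < k → f n ≡ 0ℤ

  *-vanishes : ∀ {j k} f g → VanishesBelow j f → VanishesBelow k g →
               VanishesBelow (j ℕ.+ k) (f * g)
  *-vanishes {j} {k} f g f↓ g↓ {n} n<j+k =
    trans (sum-cong-≗ {suc n} (λ i → term (toℕ i) (ℕ.s≤s⁻¹ (toℕ<n i))))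
          (sum-replicate-zero (suc n))
    where
    term : ∀ i → i ≤ n → f i ℤ.* g (n ∸ i) ≡ 0ℤ
    term i i≤n with i ℕ.<? j
    ... | yes i<j = cong (ℤ._* g (n ∸ i)) (f↓ i<j)
    ... | no  i≮j = trans (cong (f i ℤ.*_) (g↓ n∸i<k)) (ℤ.*-zeroʳ (f i))
      where
      n∸i<k : n ∸ i < k
      n∸i<k = ℕ.+-cancelˡ-< i (n ∸ i) k
        (subst (_< i ℕ.+ k) (sym (ℕ.m+[n∸m]≡n i≤n))
          (ℕ.<-≤-trans n<j+k (ℕ.+-monoˡ-≤ k (ℕ.≮⇒≥ i≮j))))

  q^-vanishes : ∀ k → VanishesBelow k (q ^ k)
  q^-vanishes zero    ()
  q^-vanishes (suc k) =
    *-vanishes {1} {k} q (q ^ k) (λ { {zero} _ → refl ; {suc _} (ℕ.s≤s ()) })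
      (q^-vanishes k)

  *-identityʳ : ∀ f → f * 1ₛ ≗ f
  *-identityʳ f zero    = trans (ℤ.+-identityʳ _) (ℤ.*-identityʳ (f 0))
  *-identityʳ f (suc n) =
    trans (cong₂ ℤ._+_ (ℤ.*-zeroʳ (f 0)) (*-identityʳ (λ i → f (suc i)) n))
          (ℤ.+-identityˡ _)

  factor-stable : ∀ f h {n m} → VanishesBelow m h → n < m →
                  (f * (1ₛ - h)) n ≡ f n
  factor-stable f h {n} h↓ n<m =
    trans (sum-cong-≗ {suc n} (λ i → cong (f (toℕ i) ℤ.*_) (unit (toℕ i))))
          (*-identityʳ f n)
    where
    unit : ∀ i → (1ₛ - h) (n ∸ i) ≡ 1ₛ (n ∸ i)
    unit i = trans (cong (λ z → 1ₛ (n ∸ i) ℤ.+ ℤ.- z)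
                         (h↓ (ℕ.≤-<-trans (ℕ.m∸n≤m n i) n<m)))
                   (ℤ.+-identityʳ _)

pochhammer-stable : ∀ a {n m} → n < m → pochhammer a m n ≡ pochhammer∞ a n
pochhammer-stable a {n} n<m = go (ℕ.≤⇒≤′ n<m)
  where
  go : ∀ {m} → suc n ℕ.≤′ m → pochhammer a m n ≡ pochhammer∞ a n
  go ℕ.≤′-refl             = refl
  go (ℕ.≤′-step {m} sn≤′m) =
    trans (factor-stable (pochhammer a m) (a * q ^ m)
             (*-vanishes {0} a (q ^ m) (λ ()) (q^-vanishes m))
             (ℕ.≤′⇒≤ sn≤′m))
          (go sn≤′m)

{-# OPTIONS --safe #-}
module Submission where

-- Sorting by the largest non-overlined part k, the generating function is
--   ∑_k q^k / (q;q)_k · (-q^(k+1);q)_∞ = (-q;q)_∞ · ∑_k q^k / (q²;q²)_k.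
-- Replacing q^k by x^k turns the left side into a series G(x) with
-- (1 - x) G(x) = G(q²x), so (q;q²)_∞ G(q) = G(0) = (-q;q)_∞, and Euler's identity
-- (q;q²)_∞ (-q;q)_∞ = 1 gives G(q) = (-q;q)_∞².
-- The coefficient of q^n is computed modulo q^N with N = n + 1. There q is
-- nilpotent, so all sums and products are finite, and the argument works in any
-- commutative ring with q^N = 0.

open import Algebra.Bundles using (CommutativeRing)
open import Algebra.Structures using (IsCommutativeRing)
open import Data.Bool.Base using (true; false)
open import Data.Fin.Base using (toℕ)
open import Data.Fin.Properties using (toℕ<n)
open import Data.Integer.Base as ℤ using (ℤ; 0ℤ)
import Data.Integer.Properties as ℤ
open import Data.Integer.Tactic.RingSolver using (solve-∀)
open import Data.List.Base using (List; []; _∷_; _++_; map; foldr; length)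
open import Data.List.Membership.Propositional using (_∈_)
open import Data.List.Membership.Propositional.Properties using (∈-map⁺; ∈-map⁻; ∈-++⁺ˡ; ∈-++⁺ʳ)
open import Data.List.Properties using (∷-injectiveʳ)
open import Data.List.Relation.Unary.All as All using (All; []; _∷_)
import Data.List.Relation.Unary.All.Properties as All
open import Data.List.Relation.Unary.AllPairs using (AllPairs; []; _∷_)
open import Data.List.Relation.Unary.Any using (here; there)
open import Data.List.Relation.Unary.Unique.Propositional using (Unique)
import Data.List.Relation.Unary.Unique.Propositional.Properties as Unique
open import Data.Nat.Base as ℕ using (ℕ; zero; suc; _≤_; _<_; z≤n; s≤s; NonZero)
import Data.Nat.Properties as ℕ
open import Data.Product.Base using (_×_; _,_)
open import Data.Sum.Base using (inj₁; inj₂)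
open import Function.Base using (_∘_)
open import Level using (0ℓ)
import Relation.Binary.PropositionalEquality as ≡
open import Relation.Binary.PropositionalEquality using (_≡_)
open import Relation.Nullary using (¬_; yes; no; contradiction)
open import Algebra.Properties.CommutativeMonoid.Sum ℤ.+-0-commutativeMonoid
  using (sum-cong-≗)
import Defs

-- Finite q-products in a commutative ring.

module QIdentities {c ℓ} (R : CommutativeRing c ℓ) where

  open CommutativeRing R
  open import Algebra.Properties.Ring ring
  open import Algebra.Properties.Semiring.Exp semiring
  open import Algebra.Properties.CommutativeSemiring.Exp commutativeSemiring using (^-distrib-*)
  open import Algebra.Properties.CommutativeSemigroup *-commutativeSemigroup
    using (interchange; xy∙z≈xz∙y; x∙yz≈y∙xz)
  open import Algebra.Solver.Ring.NaturalCoefficients.Default commutativeSemiring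
    using (solve; _:=_; _:+_; _:*_; con)
  open import Relation.Binary.Reasoning.Setoid setoid

  -- (a;Q)_n
  poch : Carrier → Carrier → ℕ → Carrier
  poch a Q zero    = 1#
  poch a Q (suc n) = poch a Q n * (1# - a * Q ^ n)

  x*1-y≈x-xy : ∀ x y → x * (1# - y) ≈ x - x * y
  x*1-y≈x-xy x y = trans (x[y-z]≈xy-xz x 1# y) (+-congʳ (*-identityʳ x))

  x≈z+y⇒x-y≈z : ∀ {x y z} → x ≈ z + y → x - y ≈ z
  x≈z+y⇒x-y≈z {x} {y} {z} eq = trans (+-congʳ eq) (//-rightDividesʳ y z)

  x-y≈x : ∀ {x y} → y ≈ 0# → x - y ≈ x
  x-y≈x {x} {y} y≈0 = x≈z+y⇒x-y≈z (sym (trans (+-congˡ y≈0) (+-identityʳ x)))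

  1-y*1--y : ∀ y → (1# - y) * (1# - (- y)) ≈ 1# - y * y
  1-y*1--y y = begin
    (1# - y) * (1# - (- y))      ≈⟨ *-congˡ (+-congˡ (-‿involutive y)) ⟩
    (1# - y) * (1# + y)          ≈⟨ *-comm _ _ ⟩
    (1# + y) * (1# - y)          ≈⟨ x*1-y≈x-xy _ y ⟩
    (1# + y) - (1# + y) * y      ≈⟨ x≈z+y⇒x-y≈z (sym lemma) ⟩
    1# - y * y                   ∎
    where
    lemma : 1# - y * y + (1# + y) * y ≈ 1# + y
    lemma = begin
      1# - y * y + (1# + y) * y     ≈⟨ +-congˡ (trans (distribʳ y 1# y) (trans (+-congʳ (*-identityˡ y)) (+-comm _ _))) ⟩
      1# - y * y + (y * y + y)      ≈⟨ +-assoc _ _ _ ⟨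
      1# - y * y + y * y + y        ≈⟨ +-congʳ (//-rightDividesˡ _ _) ⟩
      1# + y                        ∎

  -- Each factor splits as a difference of squares, 1 - y² = (1 - y)(1 + y) with y = a Q^n.
  poch-square : ∀ a Q n → poch (a * a) (Q * Q) n ≈ poch a Q n * poch (- a) Q n
  poch-square a Q zero    = sym (*-identityˡ 1#)
  poch-square a Q (suc n) = begin
    poch (a * a) (Q * Q) n * (1# - a * a * (Q * Q) ^ n)
      ≈⟨ *-cong (poch-square a Q n) factor ⟩
    poch a Q n * poch (- a) Q n * ((1# - y) * (1# - (- a) * Q ^ n))
      ≈⟨ interchange _ _ _ _ ⟩
    poch a Q (suc n) * poch (- a) Q (suc n) ∎
    where
    y = a * Q ^ n
    factor : 1# - a * a * (Q * Q) ^ n ≈ (1# - y) * (1# - (- a) * Q ^ n)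
    factor = begin
      1# - a * a * (Q * Q) ^ n          ≈⟨ +-congˡ (-‿cong (*-congˡ (^-distrib-* Q Q n))) ⟩
      1# - a * a * (Q ^ n * Q ^ n)      ≈⟨ +-congˡ (-‿cong (interchange _ _ _ _)) ⟩
      1# - y * y                        ≈⟨ 1-y*1--y y ⟨
      (1# - y) * (1# - (- y))           ≈⟨ *-congˡ (+-congˡ (-‿cong (-‿distribˡ-* a (Q ^ n)))) ⟩
      (1# - y) * (1# - (- a) * Q ^ n)   ∎

  -- The factors are grouped by the parity of the exponent of `Q`; the odd ones start at `a * Q`.
  poch-bisect : ∀ a Q n → poch a Q (n ℕ.+ n) ≈ poch a (Q * Q) n * poch (a * Q) (Q * Q) n
  poch-bisect a Q zero    = sym (*-identityˡ 1#)
  poch-bisect a Q (suc n) rewrite ℕ.+-suc n n = begin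
    poch a Q (n ℕ.+ n) * (1# - a * Q ^ (n ℕ.+ n)) * (1# - a * (Q * Q ^ (n ℕ.+ n)))
      ≈⟨ *-assoc _ _ _ ⟩
    poch a Q (n ℕ.+ n) * ((1# - a * Q ^ (n ℕ.+ n)) * (1# - a * (Q * Q ^ (n ℕ.+ n))))
      ≈⟨ *-cong (poch-bisect a Q n) (*-cong (+-congˡ (-‿cong (*-congˡ Q²ⁿ)))
                 (+-congˡ (-‿cong (trans (sym (*-assoc _ _ _)) (*-congˡ Q²ⁿ))))) ⟩
    poch a (Q * Q) n * poch (a * Q) (Q * Q) n *
      ((1# - a * (Q * Q) ^ n) * (1# - a * Q * (Q * Q) ^ n))
      ≈⟨ interchange _ _ _ _ ⟩
    poch a (Q * Q) (suc n) * poch (a * Q) (Q * Q) (suc n) ∎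
    where
    Q²ⁿ : Q ^ (n ℕ.+ n) ≈ (Q * Q) ^ n
    Q²ⁿ = trans (^-homo-* Q n n) (sym (^-distrib-* Q Q n))

  -- Generating functions by recursion, and their identities for nilpotent q.

  module _ (q : Carrier) where

    -- The generating function of partitions into at most b parts, each at most m.
    parts≤ : ℕ → ℕ → Carrier
    parts≤ zero    _       = 1#
    parts≤ (suc b) zero    = 1#
    parts≤ (suc b) (suc m) = parts≤ (suc b) m + q ^ suc m * parts≤ b (suc m)

    parts≤-zero : ∀ b → parts≤ b 0 ≈ 1#
    parts≤-zero zero    = refl
    parts≤-zero (suc b) = refl

    -- For x = q the generating function of 𝒢_N^O with parts at most m and at
    -- most b + 1 non-overlined parts. In general the largest non-overlined part k
    -- contributes x^k in place of q^k.
    gno : ℕ → Carrier → ℕ → Carrier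
    gno b x zero    = 1#
    gno b x (suc m) = (gno b x m + q ^ suc m * gno b x m) + x ^ suc m * parts≤ b (suc m)

    module _ (N : ℕ) (qᴺ≈0 : q ^ N ≈ 0#) where

      q^-nilpotent : ∀ {n} → N ≤ n → q ^ n ≈ 0#
      q^-nilpotent {n} N≤n = begin
        q ^ n                      ≡⟨ ≡.cong (q ^_) (ℕ.m+[n∸m]≡n N≤n) ⟨
        q ^ (N ℕ.+ (n ℕ.∸ N))      ≈⟨ ^-homo-* q N _ ⟩
        q ^ N * q ^ (n ℕ.∸ N)      ≈⟨ *-congʳ qᴺ≈0 ⟩
        0# * q ^ (n ℕ.∸ N)         ≈⟨ zeroˡ _ ⟩
        0#                         ∎

      -- The additional factors are 1 - q^j with j > N, hence equal to 1. This cuts the product of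
      -- length N + N from `poch-bisect` back to length N.
      poch-stable : ∀ k → poch q q (k ℕ.+ N) ≈ poch q q N
      poch-stable zero    = refl
      poch-stable (suc k) = begin
        poch q q (k ℕ.+ N) * (1# - q ^ suc (k ℕ.+ N))
          ≈⟨ *-congˡ (x-y≈x (q^-nilpotent (ℕ.m≤n+m N (suc k)))) ⟩
        poch q q (k ℕ.+ N) * 1#
          ≈⟨ *-identityʳ _ ⟩
        poch q q (k ℕ.+ N)
          ≈⟨ poch-stable k ⟩
        poch q q N ∎

      -- The two sides differ by q^j times the generating function of partitions into exactly b + 1
      -- parts. Such partitions have weight at least b + 1, so the difference is divisible by
      -- q^(j+b+1) = 0. The factor q^j makes the induction work: splitting off a part m + 1 lowers b
      -- by one but raises j by m + 1.
      parts≤-stable : ∀ b m j → N ≤ j ℕ.+ suc b → q ^ j * parts≤ (suc b) m ≈ q ^ j * parts≤ b m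
      parts≤-stable zero    zero    j N≤ = refl
      parts≤-stable (suc b) zero    j N≤ = refl
      parts≤-stable b       (suc m) j N≤ = begin
        q ^ j * (parts≤ (suc b) m + q ^ suc m * parts≤ b (suc m))
          ≈⟨ distribˡ _ _ _ ⟩
        q ^ j * parts≤ (suc b) m + q ^ j * (q ^ suc m * parts≤ b (suc m))
          ≈⟨ +-cong (parts≤-stable b m j N≤) (merge (parts≤ b (suc m))) ⟩
        q ^ j * parts≤ b m + q ^ (j ℕ.+ suc m) * parts≤ b (suc m)
          ≈⟨ step b N≤ ⟩
        q ^ j * parts≤ b (suc m) ∎
        where
        merge : ∀ y → q ^ j * (q ^ suc m * y) ≈ q ^ (j ℕ.+ suc m) * y
        merge y = trans (sym (*-assoc _ _ y)) (*-congʳ (sym (^-homo-* q j (suc m))))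

        shift : ∀ {b} → j ℕ.+ suc b ≤ (j ℕ.+ suc m) ℕ.+ b
        shift {b} = ℕ.≤-trans (ℕ.+-monoʳ-≤ j (ℕ.+-monoˡ-≤ b (ℕ.s≤s ℕ.z≤n)))
                              (ℕ.≤-reflexive (≡.sym (ℕ.+-assoc j (suc m) b)))

        step : ∀ b → N ≤ j ℕ.+ suc b →
               q ^ j * parts≤ b m + q ^ (j ℕ.+ suc m) * parts≤ b (suc m) ≈ q ^ j * parts≤ b (suc m)
        -- For b = 0 the hypothesis reads N ≤ j + 1, so q^(j+m+1) is already zero.
        step zero N≤ = begin
          q ^ j * 1# + q ^ (j ℕ.+ suc m) * 1#
            ≈⟨ +-congˡ (*-congʳ (q^-nilpotent
                 (ℕ.≤-trans N≤ (ℕ.≤-trans shift (ℕ.≤-reflexive (ℕ.+-identityʳ _)))))) ⟩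
          q ^ j * 1# + 0# * 1#
            ≈⟨ +-congˡ (zeroˡ 1#) ⟩
          q ^ j * 1# + 0#
            ≈⟨ +-identityʳ _ ⟩
          q ^ j * 1# ∎
        step (suc b) N≤ = begin
          q ^ j * parts≤ (suc b) m + q ^ (j ℕ.+ suc m) * parts≤ (suc b) (suc m)
            ≈⟨ +-congˡ (parts≤-stable b (suc m) (j ℕ.+ suc m) (ℕ.≤-trans N≤ shift)) ⟩
          q ^ j * parts≤ (suc b) m + q ^ (j ℕ.+ suc m) * parts≤ b (suc m)
            ≈⟨ +-congˡ (merge (parts≤ b (suc m))) ⟨
          q ^ j * parts≤ (suc b) m + q ^ j * (q ^ suc m * parts≤ b (suc m))
            ≈⟨ distribˡ _ _ _ ⟨
          q ^ j * parts≤ (suc b) (suc m) ∎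

      private
        P : ℕ → Carrier
        P = parts≤ N

        G : Carrier → ℕ → Carrier
        G = gno N

      -- The recursion of `parts≤` lowers the bound on the number of parts. Modulo q^N the bounds N
      -- and N + 1 give the same series, by `parts≤-stable` with j = 0, so the bound can be kept
      -- fixed.
      P-suc : ∀ m → P (suc m) ≈ P m + q ^ suc m * P (suc m)
      P-suc m = begin
        P (suc m)                            ≈⟨ unscaled _ ⟨
        q ^ 0 * P (suc m)                    ≈⟨ parts≤-stable N (suc m) 0 (ℕ.n≤1+n N) ⟨
        q ^ 0 * parts≤ (suc N) (suc m)       ≈⟨ unscaled _ ⟩
        parts≤ (suc N) m + q ^ suc m * P (suc m)
          ≈⟨ +-congʳ (trans (sym (unscaled _))
               (trans (parts≤-stable N m 0 (ℕ.n≤1+n N)) (unscaled _))) ⟩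
        P m + q ^ suc m * P (suc m)          ∎
        where
        unscaled : ∀ y → q ^ 0 * y ≈ y
        unscaled = *-identityˡ

      -- `P-suc` says (1 - q^(m+1)) P (m+1) = P m, so each new factor of (q;q)_m takes `P` one step
      -- back.
      P-inverse : ∀ m → P m * poch q q m ≈ 1#
      P-inverse zero    = trans (*-identityʳ _) (parts≤-zero N)
      P-inverse (suc m) = begin
        P (suc m) * (poch q q m * (1# - q ^ suc m))     ≈⟨ x∙yz≈y∙xz _ _ _ ⟩
        poch q q m * (P (suc m) * (1# - q ^ suc m))     ≈⟨ *-congˡ (x*1-y≈x-xy _ _) ⟩
        poch q q m * (P (suc m) - P (suc m) * q ^ suc m)
          ≈⟨ *-congˡ (x≈z+y⇒x-y≈z (trans (P-suc m) (+-congˡ (*-comm _ _)))) ⟩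
        poch q q m * P m                                ≈⟨ *-comm _ _ ⟩
        P m * poch q q m                                ≈⟨ P-inverse m ⟩
        1#                                              ∎

      -- Euler's identity: partitions into odd parts and into distinct parts are equinumerous.
      odd-distinct : poch q (q * q) N * poch (- q) q N ≈ 1#
      odd-distinct = begin
        poch q (q * q) N * poch (- q) q N
          ≈⟨ *-identityˡ _ ⟨
        1# * (poch q (q * q) N * poch (- q) q N)
          -- The inserted (q;q)_N combines with (-q;q)_N to (q²;q²)_N. Together with the odd factors
          -- this is (q;q)_2N, which equals (q;q)_N modulo q^N and is cancelled by `P N`.
          ≈⟨ *-congʳ (P-inverse N) ⟨
        P N * poch q q N * (poch q (q * q) N * poch (- q) q N)
          ≈⟨ *-assoc _ _ _ ⟩
        P N * (poch q q N * (poch q (q * q) N * poch (- q) q N))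
          ≈⟨ *-congˡ (x∙yz≈y∙xz _ _ _) ⟩
        P N * (poch q (q * q) N * (poch q q N * poch (- q) q N))
          ≈⟨ *-congˡ (*-congˡ (poch-square q q N)) ⟨
        P N * (poch q (q * q) N * poch (q * q) (q * q) N)
          ≈⟨ *-congˡ (poch-bisect q q N) ⟨
        P N * poch q q (N ℕ.+ N)
          ≈⟨ *-congˡ (poch-stable N) ⟩
        P N * poch q q N
          ≈⟨ P-inverse N ⟩
        1# ∎

      -- (1 - x) G x = G (q²x) - x^(m+1) P m, with both sides moved so that no subtraction occurs.
      G-functional : ∀ x m → G x m + x ^ suc m * P m ≈ x * G x m + G (q * q * x) m
      G-functional x zero    = begin
        1# + x * 1# * P 0    ≈⟨ +-congˡ (trans (*-congˡ (parts≤-zero N)) (*-identityʳ _)) ⟩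
        1# + x * 1#          ≈⟨ +-comm _ _ ⟩
        x * 1# + 1#          ∎
      G-functional x (suc m) = begin
        g + k * g + y * p₁ + x * y * p₁
          -- Two expansions of P (m+1) are made. They give y p₀ and k y p₀, which complete g and k g
          -- to the left side of the induction hypothesis, and k² y p₁, the new last term of G (q²x)
          -- (m+1).
          ≈⟨ +-congʳ (+-congˡ (*-congˡ p₁-expanded)) ⟩
        g + k * g + y * (p₀ + k * (p₀ + k * p₁)) + x * y * p₁
          ≈⟨ solve 6 (λ g k y x p₀ p₁ →
               g :+ k :* g :+ y :* (p₀ :+ k :* (p₀ :+ k :* p₁)) :+ x :* y :* p₁ :=
               (g :+ y :* p₀) :+ k :* (g :+ y :* p₀) :+ (x :* y :* p₁ :+ k :* k :* y :* p₁))
               refl g k y x p₀ p₁ ⟩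
        (g + y * p₀) + k * (g + y * p₀) + (x * y * p₁ + k * k * y * p₁)
          ≈⟨ +-congʳ (+-cong (G-functional x m) (*-congˡ (G-functional x m))) ⟩
        (x * g + g′) + k * (x * g + g′) + (x * y * p₁ + k * k * y * p₁)
          ≈⟨ solve 6 (λ g g′ k y x p₁ →
               (x :* g :+ g′) :+ k :* (x :* g :+ g′) :+ (x :* y :* p₁ :+ k :* k :* y :* p₁) :=
               x :* (g :+ k :* g :+ y :* p₁) :+ (g′ :+ k :* g′ :+ k :* k :* y :* p₁))
               refl g g′ k y x p₁ ⟩
        x * (g + k * g + y * p₁) + (g′ + k * g′ + k * k * y * p₁)
          ≈⟨ +-congˡ (+-congˡ (*-congʳ power)) ⟨
        x * (g + k * g + y * p₁) + (g′ + k * g′ + (q * q * x) ^ suc m * p₁) ∎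
        where
        g  = G x m
        g′ = G (q * q * x) m
        k  = q ^ suc m
        y  = x ^ suc m
        p₀ = P m
        p₁ = P (suc m)
        p₁-expanded : p₁ ≈ p₀ + k * (p₀ + k * p₁)
        p₁-expanded = trans (P-suc m) (+-congˡ (*-congˡ (P-suc m)))
        power : (q * q * x) ^ suc m ≈ k * k * y
        power = trans (^-distrib-* (q * q) x (suc m)) (*-congʳ (^-distrib-* q q (suc m)))

      G-cong : ∀ {x y} m → x ≈ y → G x m ≈ G y m
      G-cong zero    x≈y = refl
      G-cong (suc m) x≈y =
        +-cong (+-cong (G-cong m x≈y) (*-congˡ (G-cong m x≈y))) (*-congʳ (^-congˡ (suc m) x≈y))

      -- At x = 0 every term with a non-overlined part vanishes; the distinct overlined parts
      -- remain.
      G-zero : ∀ m → G 0# m ≈ poch (- q) q m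
      G-zero zero    = refl
      G-zero (suc m) = begin
        G 0# m + q ^ suc m * G 0# m + 0# * 0# ^ m * P (suc m)
          ≈⟨ +-congˡ (trans (*-congʳ (zeroˡ _)) (zeroˡ _)) ⟩
        G 0# m + q ^ suc m * G 0# m + 0#
          ≈⟨ +-identityʳ _ ⟩
        G 0# m + q ^ suc m * G 0# m
          ≈⟨ solve 2 (λ g k → g :+ k :* g := g :* (con 1 :+ k)) refl (G 0# m) (q ^ suc m) ⟩
        G 0# m * (1# + q ^ suc m)
          ≈⟨ *-cong (G-zero m) (+-congˡ sign) ⟩
        poch (- q) q m * (1# - (- q) * q ^ m) ∎
        where
        sign : q ^ suc m ≈ - (- q * q ^ m)
        sign = trans (sym (-‿involutive _)) (-‿cong (-‿distribˡ-* q (q ^ m)))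

      -- `G-functional` at x = q^(2k+1) turns the factor 1 - q^(2k+1) into the step from x to q²x.
      -- Its correction term x^(N+1) P N vanishes because x is a multiple of q.
      G-iterate : ∀ k → poch q (q * q) k * G q N ≈ G (q * (q * q) ^ k) N
      G-iterate zero    = trans (*-identityˡ _) (G-cong N (sym (*-identityʳ q)))
      G-iterate (suc k) = begin
        poch q (q * q) k * (1# - x) * G q N    ≈⟨ xy∙z≈xz∙y _ _ _ ⟩
        poch q (q * q) k * G q N * (1# - x)    ≈⟨ *-congʳ (G-iterate k) ⟩
        G x N * (1# - x)                       ≈⟨ x*1-y≈x-xy _ x ⟩
        G x N - G x N * x                      ≈⟨ x≈z+y⇒x-y≈z lemma ⟩
        G (q * q * x) N                        ≈⟨ G-cong N (x∙yz≈y∙xz _ _ _) ⟩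
        G (q * (q * q) ^ suc k) N              ∎
        where
        x = q * (q * q) ^ k

        error : x ^ suc N * P N ≈ 0#
        error = begin
          x ^ suc N * P N                            ≈⟨ *-congʳ (^-distrib-* q _ (suc N)) ⟩
          q ^ suc N * ((q * q) ^ k) ^ suc N * P N    ≈⟨ *-congʳ (*-congʳ (q^-nilpotent (ℕ.n≤1+n N))) ⟩
          0# * ((q * q) ^ k) ^ suc N * P N           ≈⟨ *-congʳ (zeroˡ _) ⟩
          0# * P N                                   ≈⟨ zeroˡ _ ⟩
          0#                                         ∎

        lemma : G x N ≈ G (q * q * x) N + G x N * x
        lemma = begin
          G x N                               ≈⟨ +-identityʳ _ ⟨
          G x N + 0#                          ≈⟨ +-congˡ error ⟨
          G x N + x ^ suc N * P N             ≈⟨ G-functional x N ⟩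
          x * G x N + G (q * q * x) N         ≈⟨ +-comm _ _ ⟩
          G (q * q * x) N + x * G x N         ≈⟨ +-congˡ (*-comm _ _) ⟩
          G (q * q * x) N + G x N * x         ∎

      -- Multiplying by Euler's identity contributes one factor `D`. The other is G (q^(2N+1)) after
      -- N iterations, and that argument is zero.
      gno≈poch² : gno N q N ≈ poch (- q) q N ^ 2
      gno≈poch² = begin
        G q N                                              ≈⟨ *-identityˡ _ ⟨
        1# * G q N                                         ≈⟨ *-congʳ odd-distinct ⟨
        poch q (q * q) N * D * G q N                       ≈⟨ xy∙z≈xz∙y _ _ _ ⟩
        poch q (q * q) N * G q N * D                       ≈⟨ *-congʳ (G-iterate N) ⟩
        G (q * (q * q) ^ N) N * D                          ≈⟨ *-congʳ (G-cong N vanishes) ⟩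
        G 0# N * D                                         ≈⟨ *-congʳ (G-zero N) ⟩
        D * D                                              ≈⟨ *-congˡ (*-identityʳ D) ⟨
        D ^ 2                                              ∎
        where
        D = poch (- q) q N
        vanishes : q * (q * q) ^ N ≈ 0#
        vanishes = begin
          q * (q * q) ^ N          ≈⟨ *-congˡ (^-distrib-* q q N) ⟩
          q * (q ^ N * q ^ N)      ≈⟨ *-congˡ (*-congʳ qᴺ≈0) ⟩
          q * (0# * q ^ N)         ≈⟨ *-congˡ (zeroˡ _) ⟩
          q * 0#                   ≈⟨ zeroʳ q ⟩
          0#                       ∎

-- Formal power series as a ring, and its truncation modulo q^N.

open Defs
open ≡ using (_≢_; _≗_; refl; sym; trans; cong; cong₂; module ≡-Reasoning)

-- Since (f * g) (suc n) unfolds to f 0 g(n+1) + (tail f * g) n, the ring laws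
-- follow by induction on the coefficient.
tail : PowerSeries → PowerSeries
tail f n = f (suc n)

-- The coefficient of q^n in a product involves only coefficients up to n of the factors. Hence
-- multiplication respects agreement below N.
*-cong-≤ : ∀ {f f′ g g′} n → (∀ {i} → i ≤ n → f i ≡ f′ i) → (∀ {i} → i ≤ n → g i ≡ g′ i) →
           (f * g) n ≡ (f′ * g′) n
*-cong-≤ n f≡f′ g≡g′ = sum-cong-≗ {suc n} λ i →
  cong₂ ℤ._*_ (f≡f′ (ℕ.s≤s⁻¹ (toℕ<n i))) (g≡g′ (ℕ.m∸n≤m n (toℕ i)))

zero-*ˡ : ∀ f → 0ₛ * f ≗ 0ₛ
zero-*ˡ f zero    = refl
zero-*ˡ f (suc n) = trans (ℤ.+-identityˡ _) (zero-*ˡ f n)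

*-identityˡ : ∀ f → 1ₛ * f ≗ f
*-identityˡ f zero    = trans (ℤ.+-identityʳ _) (ℤ.*-identityˡ _)
*-identityˡ f (suc n) =
  trans (cong₂ ℤ._+_ (ℤ.*-identityˡ (f (suc n))) (zero-*ˡ f n)) (ℤ.+-identityʳ _)

*-distribʳ : ∀ h f g → (f + g) * h ≗ f * h + g * h
*-distribʳ h f g zero    = identity (f 0) (g 0) (h 0)
  where
  identity : ∀ a b c → (a ℤ.+ b) ℤ.* c ℤ.+ 0ℤ ≡ (a ℤ.* c ℤ.+ 0ℤ) ℤ.+ (b ℤ.* c ℤ.+ 0ℤ)
  identity = solve-∀
*-distribʳ h f g (suc n) =
  trans (cong (λ z → (f 0 ℤ.+ g 0) ℤ.* h (suc n) ℤ.+ z) (*-distribʳ h (tail f) (tail g) n))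
        (identity (f 0) (g 0) (h (suc n)) _ _)
  where
  identity : ∀ a b c x y → (a ℤ.+ b) ℤ.* c ℤ.+ (x ℤ.+ y) ≡ (a ℤ.* c ℤ.+ x) ℤ.+ (b ℤ.* c ℤ.+ y)
  identity = solve-∀

-- Unfolding a product exposes only the head of its left factor. Commuting `tail f` with `g` exposes
-- the head of `g` too and leaves a product of two tails; after exchanging the two head terms, the
-- sum is refolded in the other order. This uses the claim at n + 1 and at n, hence the two base
-- cases.
*-comm : ∀ f g → f * g ≗ g * f
*-comm f g zero          = cong (ℤ._+ 0ℤ) (ℤ.*-comm (f 0) (g 0))
*-comm f g (suc zero)    = identity (f 0) (f 1) (g 0) (g 1)
  where
  identity : ∀ a b c d → a ℤ.* d ℤ.+ (b ℤ.* c ℤ.+ 0ℤ) ≡ c ℤ.* b ℤ.+ (d ℤ.* a ℤ.+ 0ℤ)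
  identity = solve-∀
*-comm f g (suc (suc n)) = begin
  f 0 ℤ.* g (suc (suc n)) ℤ.+ (tail f * g) (suc n)
    ≡⟨ cong (λ z → f 0 ℤ.* g (suc (suc n)) ℤ.+ z) (*-comm (tail f) g (suc n)) ⟩
  f 0 ℤ.* g (suc (suc n)) ℤ.+ (g 0 ℤ.* f (suc (suc n)) ℤ.+ (tail g * tail f) n)
    ≡⟨ cong (λ z → f 0 ℤ.* g (suc (suc n)) ℤ.+ (g 0 ℤ.* f (suc (suc n)) ℤ.+ z))
            (*-comm (tail g) (tail f) n) ⟩
  f 0 ℤ.* g (suc (suc n)) ℤ.+ (g 0 ℤ.* f (suc (suc n)) ℤ.+ (tail f * tail g) n)
    ≡⟨ exchange (f 0 ℤ.* g (suc (suc n))) (g 0 ℤ.* f (suc (suc n))) _ ⟩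
  g 0 ℤ.* f (suc (suc n)) ℤ.+ (f * tail g) (suc n)
    ≡⟨ cong (λ z → g 0 ℤ.* f (suc (suc n)) ℤ.+ z) (*-comm f (tail g) (suc n)) ⟩
  g 0 ℤ.* f (suc (suc n)) ℤ.+ (tail g * f) (suc n) ∎
  where
  open ≡-Reasoning
  exchange : ∀ a b c → a ℤ.+ (b ℤ.+ c) ≡ b ℤ.+ (a ℤ.+ c)
  exchange = solve-∀

-- `tail (f * g)` is `scale (f 0) (tail g) + tail f * g`, which is how scaling enters the proof of
-- `*-assoc`.
scale : ℤ → PowerSeries → PowerSeries
scale a f n = a ℤ.* f n

*-scaleˡ : ∀ a f g → scale a f * g ≗ scale a (f * g)
*-scaleˡ a f g zero    = identity a (f 0) (g 0)
  where
  identity : ∀ a b c → a ℤ.* b ℤ.* c ℤ.+ 0ℤ ≡ a ℤ.* (b ℤ.* c ℤ.+ 0ℤ)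
  identity = solve-∀
*-scaleˡ a f g (suc n) =
  trans (cong (λ z → a ℤ.* f 0 ℤ.* g (suc n) ℤ.+ z) (*-scaleˡ a (tail f) g n))
        (identity a (f 0) (g (suc n)) _)
  where
  identity : ∀ a b c x → a ℤ.* b ℤ.* c ℤ.+ a ℤ.* x ≡ a ℤ.* (b ℤ.* c ℤ.+ x)
  identity = solve-∀

*-assoc : ∀ f g h → (f * g) * h ≗ f * (g * h)
*-assoc f g h zero    = identity (f 0) (g 0) (h 0)
  where
  identity : ∀ a b c → (a ℤ.* b ℤ.+ 0ℤ) ℤ.* c ℤ.+ 0ℤ ≡ a ℤ.* (b ℤ.* c ℤ.+ 0ℤ) ℤ.+ 0ℤ
  identity = solve-∀
*-assoc f g h (suc n) = begin
  (f 0 ℤ.* g 0 ℤ.+ 0ℤ) ℤ.* h (suc n) ℤ.+ ((scale (f 0) (tail g) + tail f * g) * h) n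
    ≡⟨ cong (λ z → (f 0 ℤ.* g 0 ℤ.+ 0ℤ) ℤ.* h (suc n) ℤ.+ z)
            (trans (*-distribʳ h (scale (f 0) (tail g)) (tail f * g) n)
                   (cong₂ ℤ._+_ (*-scaleˡ (f 0) (tail g) h n) (*-assoc (tail f) g h n))) ⟩
  (f 0 ℤ.* g 0 ℤ.+ 0ℤ) ℤ.* h (suc n) ℤ.+
    (f 0 ℤ.* (tail g * h) n ℤ.+ (tail f * (g * h)) n)
    ≡⟨ identity (f 0) (g 0) (h (suc n)) _ _ ⟩
  f 0 ℤ.* (g 0 ℤ.* h (suc n) ℤ.+ (tail g * h) n) ℤ.+ (tail f * (g * h)) n ∎
  where
  open ≡-Reasoning
  identity : ∀ a b c x y → (a ℤ.* b ℤ.+ 0ℤ) ℤ.* c ℤ.+ (a ℤ.* x ℤ.+ y) ≡ a ℤ.* (b ℤ.* c ℤ.+ x) ℤ.+ y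
  identity = solve-∀

*-distribˡ : ∀ h f g → h * (f + g) ≗ h * f + h * g
*-distribˡ h f g n =
  trans (*-comm h (f + g) n)
        (trans (*-distribʳ h f g n) (cong₂ ℤ._+_ (*-comm f h n) (*-comm g h n)))

q*-suc : ∀ f n → (q * f) (suc n) ≡ f n
q*-suc f n = trans (ℤ.+-identityˡ _) (*-identityˡ f n)

q^m-vanishes : ∀ m n → m ≢ n → (q ^ m) n ≡ 0ℤ
q^m-vanishes zero    zero    m≢n = contradiction refl m≢n
q^m-vanishes zero    (suc n) m≢n = refl
q^m-vanishes (suc m) zero    m≢n = refl
q^m-vanishes (suc m) (suc n) m≢n = trans (q*-suc (q ^ m) n) (q^m-vanishes m n (m≢n ∘ cong suc))

AgreeBelow : ℕ → PowerSeries → PowerSeries → Set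
AgreeBelow N f g = ∀ {n} → n < N → f n ≡ g n

module _ (N : ℕ) where

  ≗⇒≈ : ∀ {f g} → f ≗ g → AgreeBelow N f g
  ≗⇒≈ f≗g {n} _ = f≗g n

  truncated-isCommutativeRing : IsCommutativeRing (AgreeBelow N) _+_ _*_ -_ 0ₛ 1ₛ
  truncated-isCommutativeRing = record
    { isRing = record
      { +-isAbelianGroup = record
        { isGroup = record
          { isMonoid = record
            { isSemigroup = record
              { isMagma = record
                { isEquivalence = record
                  { refl  = λ _ → refl
                  ; sym   = λ f≈g n<N → sym (f≈g n<N)
                  ; trans = λ f≈g g≈h n<N → trans (f≈g n<N) (g≈h n<N)
                  }
                ; ∙-cong = λ f≈f′ g≈g′ n<N → cong₂ ℤ._+_ (f≈f′ n<N) (g≈g′ n<N)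
                }
              ; assoc = λ f g h {n} _ → ℤ.+-assoc (f n) (g n) (h n)
              }
            ; identity = (λ f {n} _ → ℤ.+-identityˡ (f n)) , (λ f {n} _ → ℤ.+-identityʳ (f n))
            }
          ; inverse = (λ f {n} _ → ℤ.+-inverseˡ (f n)) , (λ f {n} _ → ℤ.+-inverseʳ (f n))
          ; ⁻¹-cong = λ f≈g n<N → cong ℤ.-_ (f≈g n<N)
          }
        ; comm = λ f g {n} _ → ℤ.+-comm (f n) (g n)
        }
      ; *-cong = λ {f} {f′} {g} {g′} f≈f′ g≈g′ {n} n<N → *-cong-≤ {f} {f′} {g} {g′} n
          (λ i≤n → f≈f′ (ℕ.≤-<-trans i≤n n<N)) (λ i≤n → g≈g′ (ℕ.≤-<-trans i≤n n<N))
      ; *-assoc    = λ f g h → ≗⇒≈ (*-assoc f g h)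
      ; *-identity = (λ f → ≗⇒≈ (*-identityˡ f))
                   , (λ f → ≗⇒≈ (λ n → trans (*-comm f 1ₛ n) (*-identityˡ f n)))
      ; distrib    = (λ h f g → ≗⇒≈ (*-distribˡ h f g)) , (λ h f g → ≗⇒≈ (*-distribʳ h f g))
      }
    ; *-comm = λ f g → ≗⇒≈ (*-comm f g)
    }

  -- ℤ[[q]] modulo q^N
  truncated : CommutativeRing 0ℓ 0ℓ
  truncated = record { isCommutativeRing = truncated-isCommutativeRing }

-- An inductive description of 𝒢_N^O.

-- m bounds the sizes of the parts.
data Plain (m : ℕ) : List Part → Set where
  []   : Plain m []
  cons : ∀ {s π} → s < m → Plain (suc s) π → Plain m (part (suc s) false ∷ π)

-- Bounding everything after an overlined part s + 1 by s makes the overlined parts distinct and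
-- also larger than all non-overlined ones.
data Separated (m : ℕ) : List Part → Set where
  plain : ∀ {π} → Plain m π → Separated m π
  cons  : ∀ {s π} → s < m → Separated s π → Separated m (part (suc s) true ∷ π)

SizeAtMost : ℕ → Part → Set
SizeAtMost m p = size p ≤ m

Plain-weaken : ∀ {m n π} → m ≤ n → Plain m π → Plain n π
Plain-weaken m≤n []           = []
Plain-weaken m≤n (cons s<m π) = cons (ℕ.<-≤-trans s<m m≤n) π

Separated-weaken : ∀ {m n π} → m ≤ n → Separated m π → Separated n π
Separated-weaken m≤n (plain π)    = plain (Plain-weaken m≤n π)
Separated-weaken m≤n (cons s<m π) = cons (ℕ.<-≤-trans s<m m≤n) π

Plain⇒sizes : ∀ {m π} → Plain m π → All (SizeAtMost m) π
Plain⇒sizes []           = []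
Plain⇒sizes (cons s<m π) = s<m ∷ All.map (λ r≤ → ℕ.≤-trans r≤ s<m) (Plain⇒sizes π)

Separated⇒sizes : ∀ {m π} → Separated m π → All (SizeAtMost m) π
Separated⇒sizes (plain π)    = Plain⇒sizes π
Separated⇒sizes (cons s<m π) =
  s<m ∷ All.map (λ r≤ → ℕ.≤-trans r≤ (ℕ.<⇒≤ s<m)) (Separated⇒sizes π)

Plain⇒nonOverlined : ∀ {m π} → Plain m π → All (λ p → ¬ Overlined p) π
Plain⇒nonOverlined []         = []
Plain⇒nonOverlined (cons _ π) = (λ ()) ∷ Plain⇒nonOverlined π

Plain⇒overpartition : ∀ {m π} → Plain m π → IsOverpartition π
Plain⇒overpartition [] = record
  { positive = [] ; nonIncreasing = [] ; overlinedFirst = [] }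
Plain⇒overpartition (cons _ π) = record
  { positive       = _ ∷ positive
  ; nonIncreasing  = Plain⇒sizes π ∷ nonIncreasing
  ; overlinedFirst = All.map (λ ¬o o → contradiction o ¬o) (Plain⇒nonOverlined π) ∷ overlinedFirst
  }
  where open IsOverpartition (Plain⇒overpartition π)

Separated⇒G-N-O : ∀ {m π} → Separated m π → G-N-O π
Separated⇒G-N-O (plain π) = record
  { isOverpartition = Plain⇒overpartition π
  ; separated       = λ p∈π _ o _ → contradiction o (All.lookup (Plain⇒nonOverlined π) p∈π)
  }
Separated⇒G-N-O {π = part (suc s) true ∷ π} (cons _ sep) = record
  { isOverpartition = record
    { positive       = _ ∷ positive
    ; nonIncreasing  = All.map ℕ.m≤n⇒m≤1+n sizes ∷ nonIncreasing
    ; overlinedFirst = All.map (λ r≤s _ → ℕ.>⇒≢ (s≤s r≤s)) sizes ∷ overlinedFirst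
    }
  ; separated = separated′
  }
  where
  open G-N-O (Separated⇒G-N-O sep)
  open IsOverpartition isOverpartition
  sizes = Separated⇒sizes sep
  separated′ : ∀ {p r} → p ∈ part (suc s) true ∷ π → r ∈ part (suc s) true ∷ π →
               Overlined p → ¬ Overlined r → size r < size p
  separated′ _           (here refl) _ ¬o = contradiction _ ¬o
  separated′ (here refl) (there r∈π) _ _  = s≤s (All.lookup sizes r∈π)
  separated′ (there p∈π) (there r∈π)      = separated p∈π r∈π

nonOverlined⇒Plain : ∀ {m π} → All (λ p → ¬ Overlined p) π → IsOverpartition π →
                     All (SizeAtMost m) π → Plain m π
nonOverlined⇒Plain [] _ _ = []
nonOverlined⇒Plain {π = part _ true ∷ _} (¬o ∷ _) _ _ = contradiction _ ¬o
nonOverlined⇒Plain {π = part zero false ∷ _} _ record { positive = () ∷ _ } _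
nonOverlined⇒Plain {π = part (suc s) false ∷ _} (_ ∷ ¬os)
  record { positive = _ ∷ pos ; nonIncreasing = ≥s ∷ dec ; overlinedFirst = _ ∷ fst } (s<m ∷ _) =
  cons s<m (nonOverlined⇒Plain ¬os
    (record { positive = pos ; nonIncreasing = dec ; overlinedFirst = fst }) ≥s)

G-N-O-tail : ∀ {p π} → G-N-O (p ∷ π) → G-N-O π
G-N-O-tail record { isOverpartition = record { positive = _ ∷ pos ; nonIncreasing = _ ∷ dec ; overlinedFirst = _ ∷ fst }
                  ; separated = sep } = record
  { isOverpartition = record { positive = pos ; nonIncreasing = dec ; overlinedFirst = fst }
  ; separated       = λ p∈π r∈π → sep (there p∈π) (there r∈π)
  }

-- After a non-overlined head no overlined part can follow: it would have to be larger than the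
-- head, against the order. After an overlined head all parts are strictly smaller, the overlined
-- ones by `overlinedFirst` and the others by `separated`.
G-N-O⇒Separated : ∀ {m π} → G-N-O π → All (SizeAtMost m) π → Separated m π
G-N-O⇒Separated {π = []} _ _ = plain []
G-N-O⇒Separated {π = part zero _ ∷ _} record { isOverpartition = record { positive = () ∷ _ } } _
G-N-O⇒Separated {π = part (suc s) false ∷ π} gno sizes = plain (nonOverlined⇒Plain
  ((λ ()) ∷ All.tabulate λ r∈π o → ℕ.<⇒≱ (separated (there r∈π) (here refl) o (λ ()))
                                        (All.lookup (nonIncreasing-head nonIncreasing) r∈π))
  isOverpartition sizes)
  where
  open G-N-O gno
  open IsOverpartition isOverpartition
  nonIncreasing-head : ∀ {R : Part → Part → Set} {p π} → AllPairs R (p ∷ π) → All (R p) π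
  nonIncreasing-head (x ∷ _) = x
G-N-O⇒Separated {π = part (suc s) true ∷ π}
  gno@record { isOverpartition = record { nonIncreasing = ≥s ∷ _ ; overlinedFirst = ≢s ∷ _ }
             ; separated = sep } (s<m ∷ _) =
  cons s<m (G-N-O⇒Separated (G-N-O-tail gno) (All.tabulate λ r∈π → below r∈π))
  where
  below : ∀ {r} → r ∈ π → size r ≤ s
  below {part t true}  r∈π = ℕ.s≤s⁻¹ (ℕ.≤∧≢⇒< (All.lookup ≥s r∈π) (All.lookup ≢s r∈π _ ∘ sym))
  below {part t false} r∈π = ℕ.s≤s⁻¹ (sep (here refl) (there r∈π) _ (λ ()))

-- Finite enumerations: soundness, completeness and uniqueness.

-- At most b parts in plains b m, at most b + 1 non-overlined ones in separateds b m.
plains : ℕ → ℕ → List (List Part)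
plains zero    _       = [] ∷ []
plains (suc b) zero    = [] ∷ []
plains (suc b) (suc m) = plains (suc b) m ++ map (part (suc m) false ∷_) (plains b (suc m))

separateds : ℕ → ℕ → List (List Part)
separateds b zero    = [] ∷ []
separateds b (suc m) =
  (separateds b m ++ map (part (suc m) true ∷_) (separateds b m))
    ++ map (part (suc m) false ∷_) (plains b (suc m))

plains-sound : ∀ b m → All (Plain m) (plains b m)
plains-sound zero    m       = [] ∷ []
plains-sound (suc b) zero    = [] ∷ []
plains-sound (suc b) (suc m) = All.++⁺
  (All.map (Plain-weaken (ℕ.n≤1+n m)) (plains-sound (suc b) m))
  (All.gmap⁺ (cons ℕ.≤-refl) (plains-sound b (suc m)))

separateds-sound : ∀ b m → All (Separated m) (separateds b m)
separateds-sound b zero    = plain [] ∷ []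
separateds-sound b (suc m) = All.++⁺
  (All.++⁺ (All.map (Separated-weaken (ℕ.n≤1+n m)) (separateds-sound b m))
           (All.gmap⁺ (cons ℕ.≤-refl) (separateds-sound b m)))
  (All.gmap⁺ (plain ∘ cons ℕ.≤-refl) (plains-sound b (suc m)))

plains-complete : ∀ b m {π} → Plain m π → length π ≤ b → π ∈ plains b m
plains-complete zero    m       []         _ = here refl
plains-complete (suc b) zero    []         _ = here refl
plains-complete (suc b) (suc m) []         _ = ∈-++⁺ˡ (plains-complete (suc b) m [] z≤n)
plains-complete (suc b) (suc m) (cons s<1+m π) (s≤s len≤b) with ℕ.m≤n⇒m<n∨m≡n (ℕ.s≤s⁻¹ s<1+m)
... | inj₁ s<m  = ∈-++⁺ˡ (plains-complete (suc b) m (cons s<m π) (s≤s len≤b))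
... | inj₂ refl = ∈-++⁺ʳ (plains (suc b) m) (∈-map⁺ _ (plains-complete b (suc m) π len≤b))

separateds-complete : ∀ b m {π} → Separated m π → length π ≤ b → π ∈ separateds b m
separateds-complete b zero    (plain []) _ = here refl
separateds-complete b (suc m) (plain []) _ =
  ∈-++⁺ˡ (∈-++⁺ˡ (separateds-complete b m (plain []) z≤n))
separateds-complete b (suc m) (plain (cons s<1+m π)) len≤b with ℕ.m≤n⇒m<n∨m≡n (ℕ.s≤s⁻¹ s<1+m)
... | inj₁ s<m  = ∈-++⁺ˡ (∈-++⁺ˡ (separateds-complete b m (plain (cons s<m π)) len≤b))
... | inj₂ refl = ∈-++⁺ʳ (separateds b m ++ _)
                    (∈-map⁺ _ (plains-complete b (suc m) π (ℕ.<⇒≤ len≤b)))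
separateds-complete b (suc m) (cons s<1+m π) len≤b with ℕ.m≤n⇒m<n∨m≡n (ℕ.s≤s⁻¹ s<1+m)
... | inj₁ s<m  = ∈-++⁺ˡ (∈-++⁺ˡ (separateds-complete b m (cons s<m π) len≤b))
... | inj₂ refl = ∈-++⁺ˡ (∈-++⁺ʳ (separateds b m)
                    (∈-map⁺ _ (separateds-complete b m π (ℕ.<⇒≤ len≤b))))

-- Every list in the second block begins with `p`, while `p` occurs in no list of the first block.
unique-++-map∷ : ∀ {πs ρs} (p : Part) → All (All (_≢ p)) πs → Unique πs → Unique ρs →
                 Unique (πs ++ map (p ∷_) ρs)
unique-++-map∷ p πs≢p πs! ρs! = Unique.++⁺ πs! (Unique.map⁺ ∷-injectiveʳ ρs!) disjoint
  where
  disjoint : ∀ {π} → ¬ (π ∈ _ × π ∈ map (p ∷_) _)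
  disjoint (π∈πs , π∈map) with ∈-map⁻ (p ∷_) π∈map
  ... | _ , _ , refl with All.lookup πs≢p π∈πs
  ... | p≢p ∷ _ = p≢p refl

small⇒≢ : ∀ {m b π} → All (SizeAtMost m) π → All (_≢ part (suc m) b) π
small⇒≢ = All.map λ { r≤m refl → ℕ.<-irrefl refl r≤m }

plains-unique : ∀ b m → Unique (plains b m)
plains-unique zero    m       = [] ∷ []
plains-unique (suc b) zero    = [] ∷ []
plains-unique (suc b) (suc m) = unique-++-map∷ (part (suc m) false)
  (All.map (small⇒≢ ∘ Plain⇒sizes) (plains-sound (suc b) m))
  (plains-unique (suc b) m) (plains-unique b (suc m))

separateds-unique : ∀ b m → Unique (separateds b m)
separateds-unique b zero    = [] ∷ []
separateds-unique b (suc m) = unique-++-map∷ (part (suc m) false)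
  (All.++⁺ (All.map (small false) sound)
           -- The head has the same size as the excluded part and differs from it only in being
           -- overlined.
           (All.gmap⁺ (λ sep → (λ ()) ∷ small false sep) sound))
  (unique-++-map∷ (part (suc m) true)
    (All.map (small true) sound) (separateds-unique b m) (separateds-unique b m))
  (plains-unique b (suc m))
  where
  sound = separateds-sound b m
  small : ∀ c {π} → Separated m π → All (_≢ part (suc m) c) π
  small c = small⇒≢ ∘ Separated⇒sizes

-- Weight bounds and generating functions of finite lists.

sizes≤weight : ∀ π → All (SizeAtMost (weight π)) π
sizes≤weight []      = []
sizes≤weight (p ∷ π) =
  ℕ.m≤m+n (size p) (weight π) ∷
  All.map (λ r≤ → ℕ.≤-trans r≤ (ℕ.m≤n+m (weight π) (size p))) (sizes≤weight π)

length≤weight : ∀ {π} → All (λ p → NonZero (size p)) π → length π ≤ weight π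
length≤weight []            = z≤n
length≤weight (nz ∷ nzs) = ℕ.+-mono-≤ (ℕ.>-nonZero⁻¹ _ {{nz}}) (length≤weight nzs)

-- This has the shape of the finite sum in `IsSumOver`, so an identity for `genFun` serves there
-- directly.
genFun : List (List Part) → PowerSeries
genFun πs n = foldr ℤ._+_ 0ℤ (map (λ π → (q ^ weight π) n) πs)

genFun-++ : ∀ πs ρs → genFun (πs ++ ρs) ≗ genFun πs + genFun ρs
genFun-++ []       ρs n = sym (ℤ.+-identityˡ _)
genFun-++ (π ∷ πs) ρs n = trans (cong (λ z → (q ^ weight π) n ℤ.+ z) (genFun-++ πs ρs n))
                                (sym (ℤ.+-assoc ((q ^ weight π) n) _ _))

*-zeroʳ : ∀ f → f * 0ₛ ≗ 0ₛ
*-zeroʳ f n = trans (*-comm f 0ₛ n) (zero-*ˡ f n)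

q^-homo-+ : ∀ m n → q ^ (m ℕ.+ n) ≗ q ^ m * q ^ n
q^-homo-+ zero    n k = sym (*-identityˡ (q ^ n) k)
q^-homo-+ (suc m) n k =
  trans (*-cong-≤ {q} {q} k (λ _ → refl) (λ {i} _ → q^-homo-+ m n i))
        (sym (*-assoc q (q ^ m) (q ^ n) k))

genFun-map∷ : ∀ p πs → genFun (map (p ∷_) πs) ≗ q ^ size p * genFun πs
genFun-map∷ p []       n = sym (*-zeroʳ (q ^ size p) n)
genFun-map∷ p (π ∷ πs) n =
  trans (cong₂ ℤ._+_ (q^-homo-+ (size p) (weight π) n) (genFun-map∷ p πs n))
        (sym (*-distribˡ (q ^ size p) (q ^ weight π) (genFun πs) n))

-- Evaluation of the generating function modulo q^N.

module _ (N : ℕ) where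

  open CommutativeRing (truncated N) using (_≈_; reflexive; setoid; +-cong; *-cong; semiring)
  open import Algebra.Properties.Semiring.Exp semiring using (^-congˡ) renaming (_^_ to _^′_)
  open import Relation.Binary.Reasoning.Setoid setoid
  open QIdentities (truncated N)

  -- The two powers take different ring structures as parameters, one with `_≗_` and one with
  -- `AgreeBelow N`, so they are identified by induction on the exponent.
  ^≡^′ : ∀ f n → f ^ n ≡ f ^′ n
  ^≡^′ f zero    = refl
  ^≡^′ f (suc n) = cong (f *_) (^≡^′ f n)

  pochhammer≡poch : ∀ a n → pochhammer a n ≡ poch a q n
  pochhammer≡poch a zero    = refl
  pochhammer≡poch a (suc n) =
    cong₂ (λ f g → f * (1ₛ - a * g)) (pochhammer≡poch a n) (^≡^′ q n)

  genFun-[[]] : genFun ([] ∷ []) ≈ 1ₛ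
  genFun-[[]] {n} _ = ℤ.+-identityʳ (1ₛ n)

  -- This is the shape shared by the clauses of `plains` and `separateds`; it turns them into the
  -- clauses of `parts≤` and of `gno` at x = q.
  genFun-++-map∷ : ∀ πs p ρs {f g} → genFun πs ≈ f → genFun ρs ≈ g →
                   genFun (πs ++ map (p ∷_) ρs) ≈ f + q ^′ size p * g
  genFun-++-map∷ πs p ρs {f} {g} πs≈f ρs≈g = begin
    genFun (πs ++ map (p ∷_) ρs)
      ≈⟨ (λ {n} _ → genFun-++ πs (map (p ∷_) ρs) n) ⟩
    genFun πs + genFun (map (p ∷_) ρs)
      ≈⟨ +-cong πs≈f (λ {n} _ → genFun-map∷ p ρs n) ⟩
    f + q ^ size p * genFun ρs
      ≈⟨ +-cong {f} (λ _ → refl) (*-cong (reflexive (^≡^′ q (size p))) ρs≈g) ⟩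
    f + q ^′ size p * g ∎

  genFun-plains : ∀ b m → genFun (plains b m) ≈ parts≤ q b m
  genFun-plains zero    m       = genFun-[[]]
  genFun-plains (suc b) zero    = genFun-[[]]
  genFun-plains (suc b) (suc m) = genFun-++-map∷ (plains (suc b) m) _ (plains b (suc m))
    (genFun-plains (suc b) m) (genFun-plains b (suc m))

  genFun-separateds : ∀ b m → genFun (separateds b m) ≈ gno q b q m
  genFun-separateds b zero    = genFun-[[]]
  genFun-separateds b (suc m) = genFun-++-map∷ (separateds b m ++ _) _ (plains b (suc m))
    (genFun-++-map∷ (separateds b m) _ (separateds b m)
      (genFun-separateds b m) (genFun-separateds b m))
    (genFun-plains b (suc m))

  genFun-separateds≈pochhammer∞² : genFun (separateds N N) ≈ pochhammer∞ (- q) ^ 2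
  genFun-separateds≈pochhammer∞² = begin
    genFun (separateds N N)   ≈⟨ genFun-separateds N N ⟩
    gno q N q N               ≈⟨ gno≈poch² q N q^N≈0 ⟩
    poch (- q) q N ^′ 2       ≡⟨ cong (_^′ 2) (pochhammer≡poch (- q) N) ⟨
    pochhammer (- q) N ^′ 2   ≈⟨ ^-congˡ 2 {pochhammer (- q) N} (pochhammer-stable (- q)) ⟩
    pochhammer∞ (- q) ^′ 2    ≡⟨ ^≡^′ (pochhammer∞ (- q)) 2 ⟨
    pochhammer∞ (- q) ^ 2     ∎
    where
    q^N≈0 : q ^′ N ≈ 0ₛ
    q^N≈0 {n} n<N = trans (cong (λ f → f n) (≡.sym (^≡^′ q N))) (q^m-vanishes N n (ℕ.>⇒≢ n<N))

mainTheorem5 : IsSumOver G-N-O (λ π → q ^ weight π) (pochhammer∞ (- q) ^ 2)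
mainTheorem5 n =
  separateds N N ,
  separateds-unique N N ,
  (λ π∈ → Separated⇒G-N-O (All.lookup (separateds-sound N N) π∈)) ,
  complete ,
  genFun-separateds≈pochhammer∞² N ℕ.≤-refl
  where
  -- Besides being the modulus, N bounds the sizes and the number of parts in the enumeration. Both
  -- are at most n for weight n, so all relevant overpartitions are listed; listed ones of other
  -- weights contribute 0.
  N = suc n
  complete : ∀ {π} → G-N-O π → (q ^ weight π) n ≢ 0ℤ → π ∈ separateds N N
  complete {π} π∈G nonzero with weight π ℕ.≟ n
  ... | no w≢n   = contradiction (q^m-vanishes (weight π) n w≢n) nonzero
  ... | yes refl = separateds-complete N N
    (G-N-O⇒Separated π∈G (All.map ℕ.m≤n⇒m≤1+n (sizes≤weight π)))
    (ℕ.m≤n⇒m≤1+n (length≤weight (IsOverpartition.positive (G-N-O.isOverpartition π∈G))))
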